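{- For every integer $\ell\geq 1$ there is a graph $G$ of pathwidth $2$ with $\pi_l(G)\geq \ell$.
   Context: All graphs are finite, simple and undirected. A vertex coloring $\phi$ of a graph $G$ is nonrepetitive if there is no path (with no repeated vertices) $u_1u_2\ldots u_{2r}$, $r\geq 1$, in $G$ with $\phi(u_i)=\phi(u_{r+i})$ for all $i\in\{1,\dots,r\}$. Given lists $L_v$ ($v\in V(G)$) of colors, a coloring with these lists is a coloring $\phi$ with $\phi(v)\in L_v$ for all $v$. The Thue choice number $\pi_l(G)$ is the minimum $\ell$ such that for every assignment of lists $L_v$ with $|L_v|\geq \ell$ for all $v\in V(G)$ there is a nonrepetitive coloring of $G$ with these lists. Pathwidth is the usual notion: the minimum, over all path decompositions of $G$, of the maximum bag size minus one. -}

module Defs where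

open import Data.Nat using (ℕ; zero; suc; _+_; _∸_; _≤_; _<_; _≥_)
import Data.Fin
open import Data.Fin using (Fin)
open import Data.Fin.Subset using (Subset; _∈_; ∣_∣)
open import Data.Bool using (Bool; true; false)
open import Data.List using (List; length; map; _++_)
open import Data.List.Membership.Propositional using () renaming (_∈_ to _∈ₗ_)
open import Data.List.Relation.Unary.Unique.Propositional using (Unique)
open import Data.List.Relation.Unary.Linked using (Linked)
open import Data.Product using (Σ; _×_; ∃; ∃-syntax)
open import Relation.Binary.PropositionalEquality using (_≡_)
open import Relation.Nullary using (¬_)

record Graph : Set where
  field
    n     : ℕ
    adj   : Fin n → Fin n → Bool
    sym   : ∀ u v → adj u v ≡ adj v u
    irrefl : ∀ v → adj v v ≡ false

open Graph public

Vertex : Graph → Set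
Vertex G = Fin (n G)

Adj : (G : Graph) → Vertex G → Vertex G → Set
Adj G u v = adj G u v ≡ true

IsPath : (G : Graph) → List (Vertex G) → Set
IsPath G p = Unique p × Linked (Adj G) p

Coloring : Graph → Set
Coloring G = Vertex G → ℕ

Repetitive : (G : Graph) → Coloring G → Set
Repetitive G φ =
  ∃[ xs ] ∃[ ys ] (IsPath G (xs ++ ys) × length xs ≡ length ys × 1 ≤ length xs
                   × map φ xs ≡ map φ ys)

Nonrepetitive : (G : Graph) → Coloring G → Set
Nonrepetitive G φ = ¬ Repetitive G φ

-- A list assignment: each vertex gets a finite set of colors, represented
-- as a duplicate-free list.
ListAssignment : Graph → Set
ListAssignment G = Vertex G → List ℕ

HasListSize≥ : (G : Graph) → ListAssignment G → ℕ → Set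
HasListSize≥ G L k = ∀ v → Unique (L v) × k ≤ length (L v)

ColoringFrom : (G : Graph) → ListAssignment G → Coloring G → Set
ColoringFrom G L φ = ∀ v → φ v ∈ₗ L v

ThueChoosable : Graph → ℕ → Set
ThueChoosable G k =
  (L : ListAssignment G) → HasListSize≥ G L k →
  ∃[ φ ] (ColoringFrom G L φ × Nonrepetitive G φ)

-- π_l(G) ≥ ℓ : since π_l(G) is the least k with ThueChoosable G k,
-- this means no k < ℓ works.
ThueChoiceNumber≥ : Graph → ℕ → Set
ThueChoiceNumber≥ G ℓ = ∀ k → k < ℓ → ¬ ThueChoosable G k

record PathDecomposition (G : Graph) : Set where
  field
    m     : ℕ
    bag   : Fin m → Subset (n G)
    cover : ∀ (v : Vertex G) → ∃[ i ] (v ∈ bag i)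
    edges : ∀ (u v : Vertex G) → Adj G u v → ∃[ i ] (u ∈ bag i × v ∈ bag i)
    contiguous : ∀ (v : Vertex G) (i j k : Fin m) →
                 Data.Fin._≤_ i j → Data.Fin._≤_ j k →
                 v ∈ bag i → v ∈ bag k → v ∈ bag j

open PathDecomposition public

WidthAtMost : (G : Graph) → PathDecomposition G → ℕ → Set
WidthAtMost G D w = ∀ i → ∣ bag D i ∣ ≤ suc w

HasPathwidth≤ : Graph → ℕ → Set
HasPathwidth≤ G w = ∃[ D ] WidthAtMost G D w

Pathwidth≡ : Graph → ℕ → Set
Pathwidth≡ G w = HasPathwidth≤ G w × (∀ w' → w' < w → ¬ HasPathwidth≤ G w')

{-# OPTIONS --safe #-}

-- Take hubs c₀, c₁, … and, between c_m and c_{m+1}, many parallel "gap" vertices adjacent to both.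
-- Give the hubs pairwise disjoint lists, and let the lists in each gap include every set of at
-- least ℓ colours taken from distinct hubs.  However the graph is coloured, gap m then misses the
-- colours of fewer than ℓ hubs ("m blocks j").  A path c_a x_a c_{a+1} x_{a+1} … x_{a+2q} has halves
-- of odd length 2q + 1, so hubs face gap vertices, and these can be chosen to match unless one of
-- 2q + 1 specific pairs (j , m), all with m - j = q or j - m = q + 1, is blocked.  Hence for each q
-- every window of q + 1 positions contains a blocked pair; different q use different pairs,
-- and Σ 1/(q+1) diverges, contradicting the bound on the number of blocked pairs.
module Submission where

open import Defs
open import Data.Bool using (_∨_)
open import Data.Bool.Properties using (∨-comm)
open import Data.Empty using (⊥)
open import Data.Fin as Fin using (Fin; zero; suc; toℕ; fromℕ<; combine; remQuot; finToFun; funToFin)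
import Data.Fin.Properties as Fin
open import Data.Fin.Subset using (Subset; inside; outside; _∈_; _∪_; ⁅_⁆; ∣_∣; _-_)
open import Data.Fin.Subset.Properties using (x∈p∪q⁻; x∈p∪q⁺; x∈⁅x⁆; x∈⁅y⁆⇒x≡y; ∣⁅x⁆∣≡1; x∈p⇒∣p-x∣<∣p∣; x∈p∧x≢y⇒x∈p-y)
open import Data.List using (List; _∷_; length; map; filter; tabulate; allFin; upTo; applyUpTo; _++_)
open import Data.List.Membership.Propositional using () renaming (_∈_ to _∈ₗ_)
open import Data.List.Membership.Propositional.Properties using (∈-map⁻; ∈-filter⁻)
open import Data.List.Properties using (length-applyUpTo; map-applyUpTo; length-map; length-tabulate; length-upTo)
import Data.List.Relation.Unary.AllPairs as AllPairs
import Data.List.Relation.Unary.Linked as Linked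
import Data.List.Relation.Unary.Linked.Properties as Linked
open import Data.List.Relation.Unary.Unique.Propositional using (Unique)
import Data.List.Relation.Unary.Unique.Propositional.Properties as Unique
open import Data.Nat using (ℕ; zero; suc; _+_; _*_; _∸_; _^_; _≤_; _<_; z≤n; s≤s; z<s; _≤?_; _<?_)
open import Data.Nat.Properties
open import Data.Nat.Tactic.RingSolver using (solve-∀)
open import Data.Product using (∃-syntax; _×_; _,_; proj₁; proj₂)
open import Data.Sum using (_⊎_; inj₁; inj₂)
open import Data.Vec using ([]; _∷_)
open import Function using (_∘_; id)
open import Relation.Binary.PropositionalEquality as ≡ using (_≡_; _≢_; refl; cong; cong₂; subst; subst₂; module ≡-Reasoning)
open import Relation.Nullary using (¬_; Dec; yes; no; contradiction; does)
open import Relation.Nullary.Decidable using (¬?; _×-dec_; _⊎-dec_; dec-true; dec-false)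

-- Finite sums of natural numbers

Σ< : ℕ → (ℕ → ℕ) → ℕ
Σ< zero    f = 0
Σ< (suc n) f = f 0 + Σ< n (f ∘ suc)

Σ<-mono : ∀ n {f g} → (∀ i → i < n → f i ≤ g i) → Σ< n f ≤ Σ< n g
Σ<-mono zero    f≤g = z≤n
Σ<-mono (suc n) f≤g = +-mono-≤ (f≤g 0 z<s) (Σ<-mono n (λ i i<n → f≤g (suc i) (s≤s i<n)))

Σ<-cong : ∀ n {f g} → (∀ i → f i ≡ g i) → Σ< n f ≡ Σ< n g
Σ<-cong zero    f≗g = refl
Σ<-cong (suc n) f≗g = cong₂ _+_ (f≗g 0) (Σ<-cong n (f≗g ∘ suc))

Σ<-const : ∀ n c → Σ< n (λ _ → c) ≡ n * c
Σ<-const zero    c = refl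
Σ<-const (suc n) c = cong (c +_) (Σ<-const n c)

Σ<-distrib-+ : ∀ n f g → Σ< n (λ i → f i + g i) ≡ Σ< n f + Σ< n g
Σ<-distrib-+ zero    f g = refl
Σ<-distrib-+ (suc n) f g
  rewrite Σ<-distrib-+ n (f ∘ suc) (g ∘ suc) = interchange (f 0) (g 0) (Σ< n (f ∘ suc)) (Σ< n (g ∘ suc))
  where
  interchange : ∀ a b c d → (a + b) + (c + d) ≡ (a + c) + (b + d)
  interchange = solve-∀

Σ<-split : ∀ m n f → Σ< (m + n) f ≡ Σ< m f + Σ< n (λ i → f (m + i))
Σ<-split zero    n f = refl
Σ<-split (suc m) n f
  rewrite Σ<-split m n (f ∘ suc) = ≡.sym (+-assoc (f 0) (Σ< m (f ∘ suc)) _)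

Σ<-monoˡ : ∀ {m n} f → m ≤ n → Σ< m f ≤ Σ< n f
Σ<-monoˡ {m} {n} f m≤n = begin
  Σ< m f                                    ≤⟨ m≤m+n _ _ ⟩
  Σ< m f + Σ< (n ∸ m) (λ i → f (m + i))     ≡⟨ Σ<-split m (n ∸ m) f ⟨
  Σ< (m + (n ∸ m)) f                        ≡⟨ cong (λ k → Σ< k f) (m+[n∸m]≡n m≤n) ⟩
  Σ< n f                                    ∎
  where open ≤-Reasoning

Σ<-shift : ∀ s {n k} f → s + n ≤ k → Σ< n (λ i → f (s + i)) ≤ Σ< k f
Σ<-shift s {n} {k} f s+n≤k = begin
  Σ< n (λ i → f (s + i))            ≤⟨ m≤n+m _ _ ⟩
  Σ< s f + Σ< n (λ i → f (s + i))   ≡⟨ Σ<-split s n f ⟨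
  Σ< (s + n) f                      ≤⟨ Σ<-monoˡ f s+n≤k ⟩
  Σ< k f                            ∎
  where open ≤-Reasoning

Σ<-swap : ∀ m n (f : ℕ → ℕ → ℕ) → Σ< m (λ i → Σ< n (f i)) ≡ Σ< n (λ j → Σ< m (λ i → f i j))
Σ<-swap zero    n f = ≡.sym (≡.trans (Σ<-const n 0) (*-zeroʳ n))
Σ<-swap (suc m) n f = ≡.trans
  (cong (Σ< n (f 0) +_) (Σ<-swap m n (f ∘ suc)))
  (≡.sym (Σ<-distrib-+ n (f 0) (λ j → Σ< m (λ i → f (suc i) j))))

Σ<-zero⁻ : ∀ n f → Σ< n f ≡ 0 → ∀ i → i < n → f i ≡ 0
Σ<-zero⁻ (suc n) f eq zero    _         = m+n≡0⇒m≡0 (f 0) eq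
Σ<-zero⁻ (suc n) f eq (suc i) (s≤s i<n) = Σ<-zero⁻ n (f ∘ suc) (m+n≡0⇒n≡0 (f 0) eq) i i<n

Σ<-windows : ∀ k w f → (∀ s → s < k → 1 ≤ Σ< w (λ t → f (s * w + t))) → k ≤ Σ< (k * w) f
Σ<-windows zero    w f hit = z≤n
Σ<-windows (suc k) w f hit rewrite Σ<-split w (k * w) f =
  +-mono-≤ (hit 0 z<s) (Σ<-windows k w (λ i → f (w + i)) λ s s<k →
    ≤-trans (hit (suc s) (s≤s s<k)) (≤-reflexive (Σ<-cong w λ t → cong f (+-assoc w (s * w) t))))

Σ<≤length-filter : ∀ {A : Set} {P : A → Set} (P? : ∀ x → Dec (P x)) n (f : Fin n → A) (h : ℕ → ℕ) →
  (∀ i → h (toℕ i) ≡ 0 ⊎ (h (toℕ i) ≤ 1 × P (f i))) → Σ< n h ≤ length (filter P? (tabulate f))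
Σ<≤length-filter P? zero    f h count = z≤n
Σ<≤length-filter P? (suc n) f h count with P? (f zero) | count zero
  | Σ<≤length-filter P? n (f ∘ suc) (h ∘ suc) (count ∘ suc)
... | yes _ | inj₁ h0≡0       | ih rewrite h0≡0 = m≤n⇒m≤1+n ih
... | yes _ | inj₂ (h0≤1 , _) | ih = +-mono-≤ h0≤1 ih
... | no _  | inj₁ h0≡0       | ih rewrite h0≡0 = ih
... | no ¬p | inj₂ (_ , p)    | ih = contradiction p ¬p

-- Counting blocked pairs

-- `b j m` is non-zero when hub j is blocked in gap m.  `Free b a q` lists the pairs
-- that must be unblocked for the walk c_a x_a c_{a+1} … x_{a+2q} to be coloured as a square.
Free : (ℕ → ℕ → ℕ) → ℕ → ℕ → Set
Free b a q = (∀ t → t ≤ q → b (a + t) (a + t + q) ≡ 0)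
           × (∀ t → t < q → b (suc (a + t + q)) (a + t) ≡ 0)

-- With K = 2^P, positions and values of q below K produce indices up to 2K - 1, hence the range
-- `2 ^ P + 2 ^ P`. A power of two lets windows of every dyadic length tile K exactly.
module Blocking (κ P : ℕ) (b : ℕ → ℕ → ℕ)
  (sparse : ∀ m → m < 2 ^ P + 2 ^ P → Σ< (2 ^ P + 2 ^ P) (λ j → b j m) ≤ κ)
  (¬free : ∀ a q → a + (q + q) < 2 ^ P + 2 ^ P → ¬ Free b a q) where

  private
    K = 2 ^ P

  β : ℕ → ℕ → ℕ
  β q i = b i (i + q) + b (suc (i + q)) i

  total : ℕ → ℕ
  total q = Σ< K (β q)

  -- If the sum vanished, so would every term; as q < w, the window reaches all offsets t ≤ q that
  -- `Free` asks for, contradicting `¬free`.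
  window-hit : ∀ q w a → q < w → a + w ≤ K → 1 ≤ Σ< w (λ t → β q (a + t))
  window-hit q w a q<w a+w≤K with Σ< w (λ t → β q (a + t)) in eq
  ... | suc _ = s≤s z≤n
  ... | zero  = contradiction
    ( (λ t t≤q → m+n≡0⇒m≡0 _ (β≡0 t (≤-<-trans t≤q q<w)))
    , (λ t t<q → m+n≡0⇒n≡0 (b (a + t) (a + t + q)) (β≡0 t (<-trans t<q q<w))))
    (¬free a q in-range)
    where
    β≡0 = Σ<-zero⁻ w (λ t → β q (a + t)) eq
    in-range : a + (q + q) < K + K
    in-range = begin-strict
      a + (q + q) ≡⟨ +-assoc a q q ⟨
      a + q + q   <⟨ +-mono-≤-< (+-monoʳ-≤ a (<⇒≤ q<w)) q<w ⟩
      a + w + w   ≤⟨ +-mono-≤ a+w≤K (≤-trans (m≤n+m w a) a+w≤K) ⟩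
      K + K       ∎
      where open ≤-Reasoning

  -- K splits into 2^d disjoint windows of length 2^p, and each is hit because q < 2^p.
  total-lower : ∀ p d → d + p ≡ P → ∀ q → q < 2 ^ p → 2 ^ d ≤ total q
  total-lower p d d+p≡P q q<w =
    subst (λ k → 2 ^ d ≤ Σ< k (β q)) K≡ (Σ<-windows (2 ^ d) w (β q) hit)
    where
    w = 2 ^ p
    K≡ : 2 ^ d * w ≡ K
    K≡ = ≡.trans (≡.sym (^-distribˡ-+-* 2 d p)) (cong (2 ^_) d+p≡P)
    hit : ∀ s → s < 2 ^ d → 1 ≤ Σ< w (λ t → β q (s * w + t))
    hit s s<2^d = window-hit q w (s * w) q<w
      (≤-trans (≤-reflexive (+-comm (s * w) w)) (≤-trans (*-monoˡ-≤ w s<2^d) (≤-reflexive K≡)))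

  -- Each dyadic block of values of q contributes K / 2, as in the divergence of the harmonic series.
  totals-lower : ∀ p d → d + p ≡ P → p * K ≤ 2 * Σ< (2 ^ p) total
  totals-lower zero    d _     = z≤n
  totals-lower (suc p) d d+p≡P = begin
    K + p * K                                                       ≤⟨ +-mono-≤ block (totals-lower p (suc d) (≡.trans (≡.sym (+-suc d p)) d+p≡P)) ⟩
    2 * Σ< w (λ i → total (w + i)) + 2 * Σ< w total                 ≡⟨ +-comm (2 * Σ< w (λ i → total (w + i))) _ ⟩
    2 * Σ< w total + 2 * Σ< w (λ i → total (w + i))                 ≡⟨ *-distribˡ-+ 2 (Σ< w total) _ ⟨
    2 * (Σ< w total + Σ< w (λ i → total (w + i)))                   ≡⟨ cong (2 *_) (Σ<-split w w total) ⟨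
    2 * Σ< (w + w) total                                            ≡⟨ cong (λ k → 2 * Σ< (w + k) total) (+-identityʳ w) ⟨
    2 * Σ< (2 ^ suc p) total                                        ∎
    where
    open ≤-Reasoning
    w = 2 ^ p
    block : K ≤ 2 * Σ< w (λ i → total (w + i))
    block = begin
      K                                 ≡⟨ cong (2 ^_) d+p≡P ⟨
      2 ^ (d + suc p)                   ≡⟨ cong (2 ^_) (+-comm d (suc p)) ⟩
      2 * 2 ^ (p + d)                   ≡⟨ cong (2 *_) (^-distribˡ-+-* 2 p d) ⟩
      2 * (w * 2 ^ d)                   ≡⟨ cong (2 *_) (Σ<-const w (2 ^ d)) ⟨
      2 * Σ< w (λ _ → 2 ^ d)            ≤⟨ *-monoʳ-≤ 2 (Σ<-mono w λ i i<w → total-lower (suc p) d d+p≡P (w + i)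
                                             (+-monoʳ-< w (<-≤-trans i<w (≤-reflexive (≡.sym (+-identityʳ w)))))) ⟩
      2 * Σ< w (λ i → total (w + i))    ∎

  -- Double counting: within each kind of pair distinct q give distinct pairs, so each gap is
  -- charged at most κ. Pairs (i, i + q) use gaps below 2K, pairs (i + q + 1, i) only gaps below K.
  totals-upper : Σ< K total ≤ (K + K) * κ + K * κ
  totals-upper = begin
    Σ< K total
      ≡⟨ Σ<-cong K (λ q → Σ<-distrib-+ K (λ i → b i (i + q)) (λ i → b (suc (i + q)) i)) ⟩
    Σ< K (λ q → Σ< K (λ i → b i (i + q)) + Σ< K (λ i → b (suc (i + q)) i))
      ≡⟨ Σ<-distrib-+ K (λ q → Σ< K (λ i → b i (i + q))) (λ q → Σ< K (λ i → b (suc (i + q)) i)) ⟩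
    Σ< K (λ q → Σ< K (λ i → b i (i + q))) + Σ< K (λ q → Σ< K (λ i → b (suc (i + q)) i))
      ≤⟨ +-mono-≤ below above ⟩
    (K + K) * κ + K * κ ∎
    where
    open ≤-Reasoning
    below : Σ< K (λ q → Σ< K (λ i → b i (i + q))) ≤ (K + K) * κ
    below = begin
      Σ< K (λ q → Σ< K (λ i → b i (i + q)))       ≡⟨ Σ<-swap K K (λ q i → b i (i + q)) ⟩
      -- For a fixed hub i the gaps i + q form a stretch of the 2K gaps; widening it to all of them
      -- permits the second exchange.
      Σ< K (λ i → Σ< K (λ q → b i (i + q)))       ≤⟨ Σ<-mono K (λ i i<K → Σ<-shift i (b i) (+-monoˡ-≤ K (<⇒≤ i<K))) ⟩
      Σ< K (λ i → Σ< (K + K) (b i))               ≡⟨ Σ<-swap K (K + K) b ⟩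
      Σ< (K + K) (λ m → Σ< K (λ i → b i m))       ≤⟨ Σ<-mono (K + K) (λ m m<2K → ≤-trans (Σ<-monoˡ (λ i → b i m) (m≤m+n K K)) (sparse m m<2K)) ⟩
      Σ< (K + K) (λ _ → κ)                        ≡⟨ Σ<-const (K + K) κ ⟩
      (K + K) * κ                                 ∎
    above : Σ< K (λ q → Σ< K (λ i → b (suc (i + q)) i)) ≤ K * κ
    above = begin
      Σ< K (λ q → Σ< K (λ i → b (suc (i + q)) i)) ≡⟨ Σ<-swap K K (λ q i → b (suc (i + q)) i) ⟩
      Σ< K (λ i → Σ< K (λ q → b (suc (i + q)) i)) ≤⟨ Σ<-mono K (λ i i<K → ≤-trans
                                                       (Σ<-shift (suc i) (λ j → b j i) (+-monoˡ-≤ K i<K))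
                                                       (sparse i (<-≤-trans i<K (m≤m+n K K)))) ⟩
      Σ< K (λ _ → κ)                              ≡⟨ Σ<-const K κ ⟩
      K * κ                                       ∎

  -- The P dyadic blocks force a total of at least P * K / 2, against the upper bound 3 * K * κ.
  -- Since K cancels, P can be chosen from κ alone.
  scale-bound : P ≤ 6 * κ
  scale-bound = *-cancelʳ-≤ P (6 * κ) K {{m^n≢0 2 P}} (begin
    P * K                        ≤⟨ totals-lower P 0 refl ⟩
    2 * Σ< K total               ≤⟨ *-monoʳ-≤ 2 totals-upper ⟩
    2 * ((K + K) * κ + K * κ)    ≡⟨ collect K κ ⟩
    6 * κ * K                    ∎)
    where
    open ≤-Reasoning
    collect : ∀ n κ → 2 * ((n + n) * κ + n * κ) ≡ 6 * κ * n
    collect = solve-∀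

-- Subsets and pathwidth

∣p∪q∣≤∣p∣+∣q∣ : ∀ {n} (p q : Subset n) → ∣ p ∪ q ∣ ≤ ∣ p ∣ + ∣ q ∣
∣p∪q∣≤∣p∣+∣q∣ []            []            = z≤n
∣p∪q∣≤∣p∣+∣q∣ (outside ∷ p) (outside ∷ q) = ∣p∪q∣≤∣p∣+∣q∣ p q
∣p∪q∣≤∣p∣+∣q∣ (outside ∷ p) (inside ∷ q)  = ≤-trans (s≤s (∣p∪q∣≤∣p∣+∣q∣ p q)) (≤-reflexive (≡.sym (+-suc ∣ p ∣ ∣ q ∣)))
∣p∪q∣≤∣p∣+∣q∣ (inside ∷ p)  (outside ∷ q) = s≤s (∣p∪q∣≤∣p∣+∣q∣ p q)
∣p∪q∣≤∣p∣+∣q∣ (inside ∷ p)  (inside ∷ q)  = s≤s (≤-trans (∣p∪q∣≤∣p∣+∣q∣ p q) (+-monoʳ-≤ ∣ p ∣ (n≤1+n ∣ q ∣)))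

three-elements : ∀ {n} (p : Subset n) {x y z} → x ≢ y → y ≢ z → x ≢ z →
  x ∈ p → y ∈ p → z ∈ p → 3 ≤ ∣ p ∣
three-elements p {x} {y} {z} x≢y y≢z x≢z x∈p y∈p z∈p =
  ≤-trans (s≤s (≤-trans (s≤s (≤-trans (s≤s z≤n) (x∈p⇒∣p-x∣<∣p∣ z∈p-x-y))) (x∈p⇒∣p-x∣<∣p∣ y∈p-x))) (x∈p⇒∣p-x∣<∣p∣ x∈p)
  where
  y∈p-x : y ∈ p - x
  y∈p-x = x∈p∧x≢y⇒x∈p-y y∈p (x≢y ∘ ≡.sym)
  z∈p-x-y : z ∈ (p - x) - y
  z∈p-x-y = x∈p∧x≢y⇒x∈p-y (x∈p∧x≢y⇒x∈p-y z∈p (x≢z ∘ ≡.sym)) (y≢z ∘ ≡.sym)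

module _ (G : Graph) (D : PathDecomposition G) where

  -- `u` lies in both outer bags, hence by contiguity in the middle one, which already holds `v` and
  -- `w`. Renaming the vertices adapts this to every order of the three bags.
  middle-bag : ∀ {u v w : Vertex G} {i j k} → i Fin.≤ j → j Fin.≤ k →
    u ∈ bag D i × v ∈ bag D i → v ∈ bag D j × w ∈ bag D j → u ∈ bag D k × w ∈ bag D k →
    ∃[ l ] (u ∈ bag D l × v ∈ bag D l × w ∈ bag D l)
  middle-bag {u} {j = j} i≤j j≤k (u∈i , _) (v∈j , w∈j) (u∈k , _) =
    j , contiguous D u _ j _ i≤j j≤k u∈i u∈k , v∈j , w∈j

  -- Helly property of intervals: of the three bags containing the edges,
  -- the middle one contains the whole triangle.
  triangle-bag : ∀ {u v w : Vertex G} → Adj G u v → Adj G v w → Adj G u w →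
    ∃[ l ] (u ∈ bag D l × v ∈ bag D l × w ∈ bag D l)
  triangle-bag {u} {v} {w} uv vw uw
    with edges D u v uv | edges D v w vw | edges D u w uw
  ... | i , u∈i , v∈i | j , v∈j , w∈j | k , u∈k , w∈k
    with Fin.≤-total i j | Fin.≤-total j k | Fin.≤-total i k
  ... | inj₁ i≤j | inj₁ j≤k | _ = middle-bag i≤j j≤k (u∈i , v∈i) (v∈j , w∈j) (u∈k , w∈k)
  ... | inj₁ i≤j | inj₂ k≤j | inj₁ i≤k =
    let l , v∈l , u∈l , w∈l = middle-bag i≤k k≤j (v∈i , u∈i) (u∈k , w∈k) (v∈j , w∈j) in l , u∈l , v∈l , w∈l
  ... | inj₁ i≤j | inj₂ k≤j | inj₂ k≤i =
    let l , w∈l , u∈l , v∈l = middle-bag k≤i i≤j (w∈k , u∈k) (u∈i , v∈i) (w∈j , v∈j) in l , u∈l , v∈l , w∈l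
  ... | inj₂ j≤i | inj₁ j≤k | inj₁ i≤k =
    let l , w∈l , v∈l , u∈l = middle-bag j≤i i≤k (w∈j , v∈j) (v∈i , u∈i) (w∈k , u∈k) in l , u∈l , v∈l , w∈l
  ... | inj₂ j≤i | inj₁ j≤k | inj₂ k≤i =
    let l , v∈l , w∈l , u∈l = middle-bag j≤k k≤i (v∈j , w∈j) (w∈k , u∈k) (v∈i , u∈i) in l , u∈l , v∈l , w∈l
  ... | inj₂ j≤i | inj₂ k≤j | _ =
    let l , u∈l , w∈l , v∈l = middle-bag k≤j j≤i (u∈k , w∈k) (w∈j , v∈j) (u∈i , v∈i) in l , u∈l , v∈l , w∈l

triangle⇒pathwidth≥2 : (G : Graph) {u v w : Vertex G} → u ≢ v → v ≢ w → u ≢ w →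
  Adj G u v → Adj G v w → Adj G u w → ∀ k → k < 2 → ¬ HasPathwidth≤ G k
triangle⇒pathwidth≥2 G u≢v v≢w u≢w uv vw uw k k<2 (D , width) =
  let l , u∈l , v∈l , w∈l = triangle-bag G D uv vw uw
  in <⇒≱ (s≤s k<2) (≤-trans (three-elements (bag D l) u≢v v≢w u≢w u∈l v∈l w∈l) (width l))

-- The graph

-- Hubs c₀, …, c_N; gap j consists of M + 1 vertices joined to c_j and c_{j+1}, and c_j is joined
-- to c_{j+1}.  Hub c_j and gap j are stored as block j of the vertex set, the hub coming first.
-- `cap` truncates indices at N, so that the last gap is joined to c_N only.
module Chain (N M : ℕ) where

  V : Set
  V = Fin (suc N * suc (suc M))

  cap : ℕ → Fin (suc N)
  cap j = fromℕ< (s≤s (m⊓n≤n j N))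

  toℕ-cap : ∀ {j} → j ≤ N → toℕ (cap j) ≡ j
  toℕ-cap {j} j≤N = ≡.trans (Fin.toℕ-fromℕ< _) (m≤n⇒m⊓n≡m j≤N)

  cap-toℕ : ∀ i → cap (toℕ i) ≡ i
  cap-toℕ i = Fin.toℕ-injective (toℕ-cap (≤-pred (Fin.toℕ<n i)))

  next : Fin (suc N) → Fin (suc N)
  next j = cap (suc (toℕ j))

  toℕ-next≤ : ∀ j → toℕ (next j) ≤ suc (toℕ j)
  toℕ-next≤ j = ≤-trans (≤-reflexive (Fin.toℕ-fromℕ< _)) (m⊓n≤m (suc (toℕ j)) N)

  ≤toℕ-next : ∀ j → toℕ j ≤ toℕ (next j)
  ≤toℕ-next j = ≤-trans (⊓-glb (n≤1+n (toℕ j)) (≤-pred (Fin.toℕ<n j))) (≤-reflexive (≡.sym (Fin.toℕ-fromℕ< _)))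

  hub : Fin (suc N) → V
  hub j = combine j zero

  gap : Fin (suc N) → Fin (suc M) → V
  gap j e = combine j (suc e)

  block : V → Fin (suc N)
  block v = proj₁ (remQuot {suc N} (suc (suc M)) v)

  block-combine : ∀ j s → block (combine j s) ≡ j
  block-combine j s = cong proj₁ (Fin.remQuot-combine j s)

  -- `combine` numbers the vertices block by block. This transfers the order of bag indices to
  -- blocks in `bagOf-contiguous`.
  block-mono : ∀ {u v} → u Fin.≤ v → block u Fin.≤ block v
  block-mono {u} {v} u≤v with toℕ (block u) ≤? toℕ (block v)
  ... | yes p = p
  ... | no ¬p = contradiction u≤v (<⇒≱ (subst₂ Fin._<_
    (Fin.combine-remQuot {suc N} (suc (suc M)) v) (Fin.combine-remQuot {suc N} (suc (suc M)) u)
    (Fin.combine-monoˡ-< {suc N} {suc (suc M)} _ _ (≰⇒> ¬p))))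

  hub≢gap : ∀ i j e → hub i ≢ gap j e
  hub≢gap i j e eq with Fin.combine-injectiveʳ i zero j (suc e) eq
  ... | ()

  hub-injective : ∀ {i j} → hub i ≡ hub j → i ≡ j
  hub-injective {i} {j} = Fin.combine-injectiveˡ {suc N} {suc (suc M)} i zero j zero

  InHub : Fin (suc N) → Fin (suc N) → Set
  InHub h j = h ≡ j ⊎ h ≡ next j

  -- `v` may itself be a hub, which yields the edges between consecutive hubs. `u ≢ v` removes the
  -- loops at hubs, also at c_N, where `next` stays put.
  Arc : V → V → Set
  Arc u v = u ≢ v × (u ≡ hub (block v) ⊎ u ≡ hub (next (block v)))

  arc? : ∀ u v → Dec (Arc u v)
  arc? u v = ¬? (u Fin.≟ v) ×-dec ((u Fin.≟ hub (block v)) ⊎-dec (u Fin.≟ hub (next (block v))))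

  graph : Graph
  graph .n          = suc N * suc (suc M)
  graph .adj u v    = does (arc? u v) ∨ does (arc? v u)
  graph .sym u v    = ∨-comm (does (arc? u v)) (does (arc? v u))
  graph .irrefl v rewrite dec-false (arc? v v) (λ (v≢v , _) → v≢v refl) = refl

  arc⇒adj : ∀ {u v} → Arc u v → Adj graph u v
  arc⇒adj {u} {v} a rewrite dec-true (arc? u v) a = refl

  arc⇒adjˢ : ∀ {u v} → Arc u v → Adj graph v u
  arc⇒adjˢ {u} {v} a = ≡.trans (graph .sym v u) (arc⇒adj a)

  adj⇒arc : ∀ u v → Adj graph u v → Arc u v ⊎ Arc v u
  adj⇒arc u v uv with arc? u v | arc? v u
  ... | yes a | _     = inj₁ a
  ... | no  _ | yes a = inj₂ a
  ... | no ¬a | no ¬b = contradiction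
    (≡.trans (≡.sym uv) (cong₂ _∨_ (dec-false (arc? u v) ¬a) (dec-false (arc? v u) ¬b))) λ ()

  bagOf : V → Subset (suc N * suc (suc M))
  bagOf v = ⁅ v ⁆ ∪ (⁅ hub (block v) ⁆ ∪ ⁅ hub (next (block v)) ⁆)

  ∣bagOf∣≤3 : ∀ v → ∣ bagOf v ∣ ≤ 3
  ∣bagOf∣≤3 v = begin
    ∣ bagOf v ∣                         ≤⟨ ∣p∪q∣≤∣p∣+∣q∣ ⁅ v ⁆ _ ⟩
    ∣ ⁅ v ⁆ ∣ + ∣ ⁅ x ⁆ ∪ ⁅ y ⁆ ∣       ≤⟨ +-monoʳ-≤ ∣ ⁅ v ⁆ ∣ (∣p∪q∣≤∣p∣+∣q∣ ⁅ x ⁆ ⁅ y ⁆) ⟩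
    ∣ ⁅ v ⁆ ∣ + (∣ ⁅ x ⁆ ∣ + ∣ ⁅ y ⁆ ∣) ≡⟨ cong₂ _+_ (∣⁅x⁆∣≡1 v) (cong₂ _+_ (∣⁅x⁆∣≡1 x) (∣⁅x⁆∣≡1 y)) ⟩
    3                                   ∎
    where
    open ≤-Reasoning
    x = hub (block v)
    y = hub (next (block v))

  self∈bagOf : ∀ v → v ∈ bagOf v
  self∈bagOf v = x∈p∪q⁺ (inj₁ (x∈⁅x⁆ v))

  hub∈bagOf : ∀ {h} v → InHub h (block v) → hub h ∈ bagOf v
  hub∈bagOf v (inj₁ refl) = x∈p∪q⁺ {p = ⁅ v ⁆} (inj₂ (x∈p∪q⁺ (inj₁ (x∈⁅x⁆ _))))
  hub∈bagOf v (inj₂ refl) = x∈p∪q⁺ {p = ⁅ v ⁆} (inj₂ (x∈p∪q⁺ {p = ⁅ hub (block v) ⁆} (inj₂ (x∈⁅x⁆ _))))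

  bagOf⁻ : ∀ {u} v → u ∈ bagOf v → u ≡ v ⊎ (∃[ h ] (u ≡ hub h × InHub h (block v)))
  bagOf⁻ v u∈ with x∈p∪q⁻ ⁅ v ⁆ _ u∈
  ... | inj₁ u∈v = inj₁ (x∈⁅y⁆⇒x≡y v u∈v)
  ... | inj₂ u∈h with x∈p∪q⁻ ⁅ hub (block v) ⁆ _ u∈h
  ...   | inj₁ u∈b = inj₂ (_ , x∈⁅y⁆⇒x≡y _ u∈b , inj₁ refl)
  ...   | inj₂ u∈n = inj₂ (_ , x∈⁅y⁆⇒x≡y _ u∈n , inj₂ refl)

  arc⇒bagOf : ∀ {u} v → Arc u v → u ∈ bagOf v
  arc⇒bagOf v (_ , inj₁ refl) = hub∈bagOf v (inj₁ refl)
  arc⇒bagOf v (_ , inj₂ refl) = hub∈bagOf v (inj₂ refl)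

  InHub⇒≤ : ∀ {h j} → InHub h j → toℕ j ≤ toℕ h
  InHub⇒≤     (inj₁ refl) = ≤-refl
  InHub⇒≤ {j = j} (inj₂ refl) = ≤toℕ-next j

  InHub⇒≤suc : ∀ {h j} → InHub h j → toℕ h ≤ suc (toℕ j)
  InHub⇒≤suc {h} (inj₁ refl) = n≤1+n (toℕ h)
  InHub⇒≤suc {j = j} (inj₂ refl) = toℕ-next≤ j

  -- Converse of the two bounds above: `InHub h j` amounts to j ≤ h ≤ j + 1, a convex condition on j
  -- even at the truncated end.
  InHub⁺ : ∀ {h j} → toℕ j ≤ toℕ h → toℕ h ≤ suc (toℕ j) → InHub h j
  InHub⁺ {h} {j} j≤h h≤1+j with m≤n⇒m<n∨m≡n h≤1+j
  ... | inj₁ h<1+j = inj₁ (Fin.toℕ-injective (≤-antisym (≤-pred h<1+j) j≤h))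
  ... | inj₂ h≡1+j = inj₂ (≡.trans (≡.sym (cap-toℕ h)) (cong cap h≡1+j))

  InHub-convex : ∀ {h i j k} → i Fin.≤ j → j Fin.≤ k → InHub h i → InHub h k → InHub h j
  InHub-convex i≤j j≤k h∈i h∈k =
    InHub⁺ (≤-trans j≤k (InHub⇒≤ h∈k)) (≤-trans (InHub⇒≤suc h∈i) (s≤s i≤j))

  -- A vertex is in a bag either as its index or as a hub of that block. Being the index at both
  -- ends forces i = j = k; otherwise `w` is a hub, which also belongs to its own block, and
  -- `InHub-convex` applies.
  bagOf-contiguous : ∀ (w i j k : V) → i Fin.≤ j → j Fin.≤ k → w ∈ bagOf i → w ∈ bagOf k → w ∈ bagOf j
  bagOf-contiguous w i j k i≤j j≤k w∈i w∈k with bagOf⁻ i w∈i | bagOf⁻ k w∈k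
  ... | inj₁ refl | inj₁ refl with refl ← Fin.≤-antisym {i = i} {j = j} i≤j j≤k = self∈bagOf i
  ... | inj₁ refl | inj₂ (h , refl , h∈k) =
    hub∈bagOf j (InHub-convex (block-mono i≤j) (block-mono j≤k) (inj₁ (≡.sym (block-combine h zero))) h∈k)
  ... | inj₂ (h , refl , h∈i) | inj₁ refl =
    hub∈bagOf j (InHub-convex (block-mono i≤j) (block-mono j≤k) h∈i (inj₁ (≡.sym (block-combine h zero))))
  ... | inj₂ (h , refl , h∈i) | inj₂ (h′ , eq , h′∈k) with refl ← hub-injective {h} {h′} eq =
    hub∈bagOf j (InHub-convex (block-mono i≤j) (block-mono j≤k) h∈i h′∈k)

  decomposition : PathDecomposition graph
  decomposition .m   = suc N * suc (suc M)
  decomposition .bag = bagOf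
  decomposition .cover v = v , self∈bagOf v
  decomposition .edges u v uv with adj⇒arc u v uv
  ... | inj₁ a = v , arc⇒bagOf v a , self∈bagOf v
  ... | inj₂ a = u , self∈bagOf u , arc⇒bagOf u a
  decomposition .contiguous = bagOf-contiguous

  arc-hub-gap : ∀ {h} j e → InHub h j → Arc (hub h) (gap j e)
  arc-hub-gap {h} j e (inj₁ refl) = hub≢gap h j e , inj₁ (cong hub (≡.sym (block-combine j (suc e))))
  arc-hub-gap {h} j e (inj₂ refl) = hub≢gap h j e , inj₂ (cong (hub ∘ next) (≡.sym (block-combine j (suc e))))

  pathwidth≡2 : 1 ≤ N → Pathwidth≡ graph 2
  pathwidth≡2 1≤N = (decomposition , ∣bagOf∣≤3) ,
    -- The triangle is c_0, c_1 and the first vertex of gap 0.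
    triangle⇒pathwidth≥2 graph {hub j} {hub k} {gap j zero} hj≢hk (hub≢gap k j zero) (hub≢gap j j zero)
      (arc⇒adjˢ {hub k} {hub j} ((hj≢hk ∘ ≡.sym) , inj₂ (cong hub k≡)))
      (arc⇒adj (arc-hub-gap j zero (inj₂ refl)))
      (arc⇒adj (arc-hub-gap j zero (inj₁ refl)))
    where
    j = cap 0
    k = next j
    k≡ : k ≡ next (block (hub j))
    k≡ = cong next (≡.sym (block-combine j zero))
    hj≢hk : hub j ≢ hub k
    -- For N = 0 truncation would identify c_0 with c_1, so `1 ≤ N` enters here.
    hj≢hk eq with ≡.trans (≡.sym (toℕ-cap {0} z≤n)) (≡.trans (cong toℕ (hub-injective {j} {k} eq))
                    (≡.trans (cong (toℕ ∘ cap ∘ suc) (toℕ-cap {0} z≤n)) (toℕ-cap 1≤N)))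
    ... | ()

  -- Paths alternating between hubs and gap vertices

  module Walk (e : ℕ → Fin (suc M)) where

    walk : ℕ → ℕ → V
    walk a zero          = hub (cap a)
    walk a (suc zero)    = gap (cap a) (e a)
    walk a (suc (suc t)) = walk (suc a) t

    walk-even : ∀ a i → walk a (i + i) ≡ hub (cap (a + i))
    walk-even a zero    = cong (hub ∘ cap) (≡.sym (+-identityʳ a))
    walk-even a (suc i) rewrite +-suc i i | +-suc a i = walk-even (suc a) i

    walk-odd : ∀ a i → walk a (suc (i + i)) ≡ gap (cap (a + i)) (e (a + i))
    walk-odd a zero    rewrite +-identityʳ a = refl
    walk-odd a (suc i) rewrite +-suc i i | +-suc a i = walk-odd (suc a) i

    -- Pairing adjacency with increasing vertex number makes distinctness along the walk a matter of
    -- transitivity.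
    Step : V → V → Set
    Step u v = u Fin.< v × Adj graph u v

    step-even : ∀ j s → Step (hub j) (gap j s)
    step-even j s = hub<gap , arc⇒adj (arc-hub-gap j s (inj₁ refl))
      where
      hub<gap : hub j Fin.< gap j s
      hub<gap rewrite Fin.toℕ-combine j (zero {n = suc M}) | Fin.toℕ-combine j (suc s) =
        +-monoʳ-< (suc (suc M) * toℕ j) z<s

    step-odd : ∀ a s → a < N → Step (gap (cap a) s) (hub (cap (suc a)))
    step-odd a s a<N = Fin.combine-monoˡ-< (suc s) zero cap< , arc⇒adjˢ (arc-hub-gap (cap a) s (inj₂ cap≡next))
      where
      cap≡next : cap (suc a) ≡ next (cap a)
      cap≡next = cong (cap ∘ suc) (≡.sym (toℕ-cap (<⇒≤ a<N)))
      cap< : cap a Fin.< cap (suc a)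
      cap< rewrite toℕ-cap (<⇒≤ a<N) | toℕ-cap a<N = ≤-refl

    -- Position t from c_a is position 2a + t of c_0 x_0 c_1 ... c_N x_N, whose last position is 2N
    -- + 1; the bound keeps the step inside.
    step : ∀ t a → suc t + (a + a) ≤ suc (N + N) → Step (walk a t) (walk a (suc t))
    step zero          a le = step-even (cap a) (e a)
    step (suc zero)    a le = step-odd a (e a) (≰⇒> λ N≤a → <⇒≱ (≤-pred le) (+-mono-≤ N≤a N≤a))
    step (suc (suc t)) a le = step t (suc a) (subst (_≤ suc (N + N)) (reindex t a) le)
      where
      reindex : ∀ t a → suc (suc (suc t)) + (a + a) ≡ suc t + (suc a + suc a)
      reindex = solve-∀

    walk-isPath : ∀ a k → k + (a + a) ≤ suc (suc (N + N)) → IsPath graph (applyUpTo (walk a) k)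
    walk-isPath a k le =
        AllPairs.map Fin.<⇒≢ (Linked.Linked⇒AllPairs Fin.<-trans (Linked.map proj₁ linked))
      , Linked.map proj₂ linked
      where
      linked : Linked.Linked Step (applyUpTo (walk a) k)
      linked = Linked.applyUpTo⁺₁ (walk a) k λ {t} st<k →
        step t a (≤-pred (≤-trans (+-monoˡ-≤ (a + a) st<k) le))

applyUpTo-++ : ∀ {A : Set} (f : ℕ → A) m n → applyUpTo f m ++ applyUpTo (λ i → f (m + i)) n ≡ applyUpTo f (m + n)
applyUpTo-++ f zero    n = refl
applyUpTo-++ f (suc m) n = cong (f 0 ∷_) (applyUpTo-++ (f ∘ suc) m n)

applyUpTo-cong : ∀ {A : Set} {f g : ℕ → A} n → (∀ i → i < n → f i ≡ g i) → applyUpTo f n ≡ applyUpTo g n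
applyUpTo-cong zero    f≗g = refl
applyUpTo-cong (suc n) f≗g = cong₂ _∷_ (f≗g 0 z<s) (applyUpTo-cong n λ i i<n → f≗g (suc i) (s≤s i<n))

even⊎odd : ∀ t → ∃[ i ] (t ≡ i + i ⊎ t ≡ suc (i + i))
even⊎odd zero    = 0 , inj₁ refl
even⊎odd (suc t) with even⊎odd t
... | i , inj₁ refl = i , inj₂ refl
... | i , inj₂ refl = suc i , inj₁ (cong suc (≡.sym (+-suc i i)))

double-cancel-≤ : ∀ {i j} → i + i ≤ j + j → i ≤ j
double-cancel-≤ {i} {j} le with i ≤? j
... | yes i≤j = i≤j
... | no  i≰j = contradiction le (<⇒≱ (+-mono-< (≰⇒> i≰j) (≰⇒> i≰j)))

-- The lists

module Lists (N κ : ℕ) where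

  -- One gap vertex for each function `Fin (suc N) → Fin (suc κ)` (value zero: hub not selected), and a
  -- spare one.
  open Chain N (suc κ ^ suc N) public

  -- Colours are coded pairs, so distinct hubs have disjoint lists. Second component zero is kept
  -- for unselected hubs, hence `suc` in the hub lists.
  colour : Fin (suc N) → Fin (suc κ) → ℕ
  colour j s = toℕ (combine j s)

  colour-injective : ∀ i s j t → colour i s ≡ colour j t → i ≡ j × s ≡ t
  colour-injective i s j t eq = Fin.combine-injective i s j t (Fin.toℕ-injective eq)

  hubList : Fin (suc N) → List ℕ
  hubList j = map (λ s → colour j (suc s)) (allFin κ)

  nonzero? : (g : Fin (suc N) → Fin (suc κ)) → ∀ j → Dec (g j ≢ zero)
  nonzero? g j = ¬? (g j Fin.≟ zero)

  selection : (Fin (suc N) → Fin (suc κ)) → List ℕ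
  selection g = map (λ j → colour j (g j)) (filter (nonzero? g) (allFin (suc N)))

  -- A selection of fewer than κ colours would break the size requirement, so it is replaced by an
  -- arbitrary list of size κ.
  selectionOrDefault : (Fin (suc N) → Fin (suc κ)) → List ℕ
  selectionOrDefault g with κ ≤? length (selection g)
  ... | yes _ = selection g
  ... | no  _ = upTo κ

  selectionOrDefault≡ : ∀ g → κ ≤ length (selection g) → selectionOrDefault g ≡ selection g
  selectionOrDefault≡ g κ≤ with κ ≤? length (selection g)
  ... | yes _ = refl
  ... | no κ≰ = contradiction κ≤ κ≰

  blockList : Fin (suc N) × Fin (suc (suc (suc κ ^ suc N))) → List ℕ
  blockList (j , zero)        = hubList j
  blockList (j , suc zero)    = upTo κ
  blockList (j , suc (suc e)) = selectionOrDefault (finToFun e)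

  lists : ListAssignment graph
  lists v = blockList (remQuot {suc N} _ v)

  upTo-large : Unique (upTo κ) × κ ≤ length (upTo κ)
  upTo-large = Unique.upTo⁺ κ , ≤-reflexive (≡.sym (length-upTo κ))

  selection-unique : ∀ g → Unique (selection g)
  selection-unique g = Unique.map⁺ (λ {i} {j} → proj₁ ∘ colour-injective i (g i) j (g j))
    (Unique.filter⁺ (nonzero? g) (Unique.allFin⁺ (suc N)))

  blockList-large : ∀ js → Unique (blockList js) × κ ≤ length (blockList js)
  blockList-large (j , zero) =
      Unique.map⁺ (λ {s} {t} → Fin.suc-injective ∘ proj₂ ∘ colour-injective j (suc s) j (suc t)) (Unique.allFin⁺ κ)
    , ≤-reflexive (≡.sym (≡.trans (length-map _ (allFin κ)) (length-tabulate id)))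
  blockList-large (j , suc zero) = upTo-large
  blockList-large (j , suc (suc e)) with κ ≤? length (selection (finToFun e))
  ... | yes κ≤ = selection-unique (finToFun e) , κ≤
  ... | no  _  = upTo-large

  lists-large : HasListSize≥ graph lists κ
  lists-large v = blockList-large (remQuot {suc N} _ v)

  -- Blocked hubs of a given colouring

  module _ (φ : Coloring graph) (φ∈lists : ColoringFrom graph lists φ) where

    φ∈blockList : ∀ j s → φ (combine j s) ∈ₗ blockList (j , s)
    φ∈blockList j s = subst (λ js → φ (combine j s) ∈ₗ blockList js) (Fin.remQuot-combine j s) (φ∈lists (combine j s))

    hub-colour : ∀ j → ∃[ s ] (φ (hub j) ≡ colour j (suc s))
    hub-colour j with ∈-map⁻ _ (φ∈blockList j zero)
    ... | s , _ , eq = s , eq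

    seen? : ∀ j m → Dec (∃[ e ] (φ (gap m e) ≡ φ (hub j)))
    seen? j m = Fin.any? (λ e → φ (gap m e) ≟ φ (hub j))

    blocked : Fin (suc N) → Fin (suc N) → ℕ
    blocked j m with seen? j m
    ... | yes _ = 0
    ... | no  _ = 1

    -- The hubs blocked in gap m together with their colours under φ, coded as one of the functions
    -- that index gap vertices.
    blockedHubs : Fin (suc N) → Fin (suc N) → Fin (suc κ)
    blockedHubs m j with seen? j m
    ... | yes _ = zero
    ... | no  _ = suc (proj₁ (hub-colour j))

    blocked⇒selected : ∀ j m → blocked j m ≡ 0 ⊎ (blocked j m ≤ 1 × blockedHubs m j ≢ zero)
    blocked⇒selected j m with seen? j m
    ... | yes _ = inj₁ refl
    ... | no  _ = inj₂ (≤-refl , λ ())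

    selected⇒unseen : ∀ j m → blockedHubs m j ≢ zero →
      colour j (blockedHubs m j) ≡ φ (hub j) × (∀ e → φ (gap m e) ≢ φ (hub j))
    selected⇒unseen j m selected with seen? j m
    ... | yes _      = contradiction refl selected
    ... | no  unseen = ≡.sym (proj₂ (hub-colour j)) , λ e eq → unseen (e , eq)

    -- If gap m blocked κ hubs, then the vertex of that gap whose list consists of
    -- the colours of these hubs could not be coloured.
    blocked-sparse : ∀ m → Σ< (suc N) (λ j → blocked (cap j) m) ≤ κ
    blocked-sparse m = ≮⇒≥ λ many → refute (≤-trans (<⇒≤ many) count)
      where
      e = funToFin (blockedHubs m)
      -- Decoding `e` returns `blockedHubs m` only pointwise, hence the transports along `g≗`.
      g = finToFun e
      g≗ : ∀ j → g j ≡ blockedHubs m j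
      g≗ = Fin.finToFun-funToFin (blockedHubs m)
      count : Σ< (suc N) (λ j → blocked (cap j) m) ≤ length (selection g)
      count = ≤-trans
        (Σ<≤length-filter (nonzero? g) (suc N) id (λ j → blocked (cap j) m) λ i →
          subst₂ (λ j s → blocked j m ≡ 0 ⊎ (blocked j m ≤ 1 × s ≢ zero)) (≡.sym (cap-toℕ i)) (≡.sym (g≗ i)) (blocked⇒selected i m))
        (≤-reflexive (≡.sym (length-map _ (filter (nonzero? g) (allFin (suc N))))))
      member : κ ≤ length (selection g) → φ (gap m (suc e)) ∈ₗ selection g
      member κ≤ = subst (φ (gap m (suc e)) ∈ₗ_) (selectionOrDefault≡ g κ≤) (φ∈blockList m (suc (suc e)))
      refute : κ ≤ length (selection g) → ⊥
      refute κ≤ with ∈-map⁻ _ (member κ≤)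
      ... | j , j∈ , eq with selected⇒unseen j m (subst (_≢ zero) (g≗ j) (proj₂ (∈-filter⁻ (nonzero? g) {xs = allFin (suc N)} j∈)))
      ...   | col≡ , unseen = unseen (suc e) (≡.trans eq (≡.trans (cong (colour j) (g≗ j)) col≡))

    pick : Fin (suc N) → Fin (suc N) → Fin (suc (suc κ ^ suc N))
    pick j m with seen? j m
    ... | yes (e , _) = e
    -- A default value: `pick-colour` demands a match only for unblocked pairs.
    ... | no  _       = zero

    pick-colour : ∀ j m → blocked j m ≡ 0 → φ (gap m (pick j m)) ≡ φ (hub j)
    pick-colour j m unblocked with seen? j m
    ... | yes (_ , eq) = eq
    pick-colour j m () | no _

    blockedℕ : ℕ → ℕ → ℕ
    blockedℕ j m = blocked (cap j) (cap m)

    -- A repetitive path from unblocked pairs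

    module Square (a q : ℕ) (in-range : a + (q + q) ≤ N) (free : Free blockedℕ a q) where

      -- The gap vertex x_m sits at distance 2q + 1 from hub `target m` on the walk.
      target : ℕ → ℕ
      target m with m <? a + q
      ... | yes _ = suc (m + q)
      ... | no  _ = m ∸ q

      target-first : ∀ {i} → i < q → target (a + i) ≡ suc (a + i + q)
      target-first {i} i<q with a + i <? a + q
      ... | yes _ = refl
      ... | no  ≮ = contradiction (+-monoʳ-< a i<q) ≮

      target-second : ∀ i → target (a + i + q) ≡ a + i
      target-second i with a + i + q <? a + q
      ... | yes lt = contradiction lt (≤⇒≯ (+-monoˡ-≤ q (m≤m+n a i)))
      ... | no  _  = m+n∸n≡m (a + i) q

      open Walk (λ m → pick (cap (target m)) (cap m))

      r : ℕ
      r = suc (q + q)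

      isPath : IsPath graph (applyUpTo (walk a) (r + r))
      -- The last of the 4q + 2 vertices is x_{a+2q}, so a + 2q ≤ N suffices.
      isPath = walk-isPath a (r + r) (subst (_≤ suc (suc (N + N))) (≡.sym (collect a q)) (s≤s (s≤s (+-mono-≤ in-range in-range))))
        where
        collect : ∀ a q → suc (q + q) + suc (q + q) + (a + a) ≡ suc (suc ((a + (q + q)) + (a + (q + q))))
        collect = solve-∀

      -- Shifting by 2q + 1 sends position 2i to 2(i + q) + 1, in gap a + i + q, whose target is hub
      -- a + i. The first component of `free` lets the picked gap vertex repeat that hub's colour.
      colours-agree-even : ∀ i → i ≤ q → φ (walk a (i + i)) ≡ φ (walk a (r + (i + i)))
      colours-agree-even i i≤q = begin
        φ (walk a (i + i))                                              ≡⟨ cong φ (walk-even a i) ⟩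
        φ (hub (cap (a + i)))                                           ≡⟨ pick-colour _ _ (proj₁ free i i≤q) ⟨
        φ (gap (cap (a + i + q)) (pick (cap (a + i)) (cap (a + i + q)))) ≡⟨ cong (λ j → φ (gap (cap (a + i + q)) (pick (cap j) (cap (a + i + q))))) (target-second i) ⟨
        φ (gap (cap (a + i + q)) (pick (cap (target (a + i + q))) (cap (a + i + q))))
          ≡⟨ cong (λ m → φ (gap (cap m) (pick (cap (target m)) (cap m)))) (+-assoc a i q) ⟩
        φ (gap (cap (a + (i + q))) (pick (cap (target (a + (i + q)))) (cap (a + (i + q))))) ≡⟨ cong φ (walk-odd a (i + q)) ⟨
        φ (walk a (suc ((i + q) + (i + q))))                            ≡⟨ cong (φ ∘ walk a) (collect i q) ⟩
        φ (walk a (r + (i + i)))                                        ∎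
        where
        open ≡-Reasoning
        collect : ∀ i q → suc ((i + q) + (i + q)) ≡ suc (q + q) + (i + i)
        collect = solve-∀

      -- Here the gap vertex is in the first half and repeats the colour of hub a + i + q + 1 in the
      -- second. The first half ends with a hub, so only i < q occurs.
      colours-agree-odd : ∀ i → i < q → φ (walk a (suc (i + i))) ≡ φ (walk a (r + suc (i + i)))
      colours-agree-odd i i<q = begin
        φ (walk a (suc (i + i)))                                        ≡⟨ cong φ (walk-odd a i) ⟩
        φ (gap (cap (a + i)) (pick (cap (target (a + i))) (cap (a + i)))) ≡⟨ cong (λ j → φ (gap (cap (a + i)) (pick (cap j) (cap (a + i))))) (target-first i<q) ⟩
        φ (gap (cap (a + i)) (pick (cap (suc (a + i + q))) (cap (a + i)))) ≡⟨ pick-colour _ _ (proj₂ free i i<q) ⟩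
        φ (hub (cap (suc (a + i + q))))                                 ≡⟨ cong (φ ∘ hub ∘ cap) (shift a i q) ⟩
        φ (hub (cap (a + suc (i + q))))                                 ≡⟨ cong φ (walk-even a (suc (i + q))) ⟨
        φ (walk a (suc (i + q) + suc (i + q)))                          ≡⟨ cong (φ ∘ walk a) (collect i q) ⟩
        φ (walk a (r + suc (i + i)))                                    ∎
        where
        open ≡-Reasoning
        shift : ∀ a i q → suc (a + i + q) ≡ a + suc (i + q)
        shift = solve-∀
        collect : ∀ i q → suc (i + q) + suc (i + q) ≡ suc (q + q) + suc (i + i)
        collect = solve-∀

      colours-agree : ∀ t → t < r → φ (walk a t) ≡ φ (walk a (r + t))
      colours-agree t t<r = by-parity (even⊎odd t)
        where
        Agree : ℕ → Set
        Agree t = t < r → φ (walk a t) ≡ φ (walk a (r + t))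
        by-parity : ∃[ i ] (t ≡ i + i ⊎ t ≡ suc (i + i)) → φ (walk a t) ≡ φ (walk a (r + t))
        by-parity (i , inj₁ t≡) = subst Agree (≡.sym t≡)
          (λ lt → colours-agree-even i (double-cancel-≤ (≤-pred lt))) t<r
        by-parity (i , inj₂ t≡) = subst Agree (≡.sym t≡)
          (λ lt → colours-agree-odd i (≰⇒> λ q≤i → <⇒≱ (≤-pred lt) (+-mono-≤ q≤i q≤i))) t<r

      repetitive : Repetitive graph φ
      repetitive = xs , ys
        , subst (IsPath graph) (≡.sym (applyUpTo-++ (walk a) r r)) isPath
        , ≡.trans (length-applyUpTo (walk a) r) (≡.sym (length-applyUpTo (λ t → walk a (r + t)) r))
        , s≤s z≤n
        , (begin
             map φ xs                              ≡⟨ map-applyUpTo (walk a) φ r ⟩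
             applyUpTo (φ ∘ walk a) r              ≡⟨ applyUpTo-cong r colours-agree ⟩
             applyUpTo (λ t → φ (walk a (r + t))) r ≡⟨ map-applyUpTo (λ t → walk a (r + t)) φ r ⟨
             map φ ys                              ∎)
        where
        open ≡-Reasoning
        xs = applyUpTo (walk a) r
        ys = applyUpTo (λ t → walk a (r + t)) r

-- Choice of the scale and conclusion

scale : ℕ → ℕ
scale κ = suc (6 * κ)

module BadChain (κ : ℕ) where

  open Lists (2 ^ scale κ + 2 ^ scale κ) κ public

  lists-bad : ∀ φ → ColoringFrom graph lists φ → ¬ Nonrepetitive graph φ
  -- `scale κ` is 6 * κ + 1, just above what `scale-bound` permits.
  lists-bad φ φ∈lists nonrep = <-irrefl refl (Blocking.scale-bound κ (scale κ) (blockedℕ φ φ∈lists)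
    -- There are N + 1 = 2K + 1 hubs, while `Blocking` sums over the first 2K.
    (λ m _ → ≤-trans (Σ<-monoˡ (λ j → blockedℕ φ φ∈lists j m) (n≤1+n (2 ^ scale κ + 2 ^ scale κ))) (blocked-sparse φ φ∈lists (cap m)))
    (λ a q in-range free → nonrep (Square.repetitive φ φ∈lists a q (<⇒≤ in-range) free)))

theorem1 : ∀ (ℓ : ℕ) → 1 ≤ ℓ → ∃[ G ] (Pathwidth≡ G 2 × ThueChoiceNumber≥ G ℓ)
theorem1 ℓ _ = graph , pathwidth≡2 (≤-trans (m^n>0 2 (scale ℓ)) (m≤m+n _ _)) , λ k k<ℓ choosable →
  -- Lists of size at least ℓ also meet the smaller demand k, so one assignment refutes every k < ℓ.
  let φ , φ∈lists , nonrep = choosable lists λ v → proj₁ (lists-large v) , ≤-trans (<⇒≤ k<ℓ) (proj₂ (lists-large v))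
  in lists-bad φ φ∈lists nonrep
  where open BadChain ℓ
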